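{- Let $n$ and $k$ be positive integers with $n \geq 2k \geq 4$ and $n \geq 2k^3-2k^2-2k+4$. Then $\chi_s(\mathrm{KG}(n,k)) = \chi_s(\mathrm{KG}(n-1,k)) + 2$.
   Context: For $n \geq 2k$, the Kneser graph $\mathrm{KG}(n,k)$ is the graph whose vertices are the $k$-element subsets of $[n]=\{1,\ldots,n\}$, two vertices $A,B$ being adjacent iff $A\cap B=\emptyset$. A star-free coloring of a graph $G$ is a proper coloring $c: V(G)\to\mathbb{N}$ such that no path on three vertices is colored with just two consecutive integers. The star-free chromatic number $\chi_s(G)$ is the minimum positive integer $t$ such that there is a star-free coloring $c: V(G)\to\{1,\ldots,t\}$. -}

module Defs where

open import Data.Nat using (ℕ; suc; _≤_)
open import Data.Fin using (Fin)
open import Data.Fin.Subset using (Subset; _∩_; ∣_∣; Empty)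
open import Data.Product using (Σ; ∃; _×_; proj₁)
open import Data.Sum using (_⊎_)
open import Relation.Binary.PropositionalEquality using (_≡_; _≢_)
open import Relation.Nullary using (¬_)

record Graph : Set₁ where
  field
    V   : Set
    Adj : V → V → Set
open Graph public

KG : ℕ → ℕ → Graph
KG n k = record
  { V   = Σ (Subset n) (λ s → ∣ s ∣ ≡ k)
  ; Adj = λ A B → Empty (proj₁ A ∩ proj₁ B)
  }

Proper : (G : Graph) → (V G → ℕ) → Set
Proper G c = ∀ u v → Adj G u v → c u ≢ c v

TwoConsecutive : ℕ → ℕ → ℕ → Set
TwoConsecutive a b c = ∃ λ i → (a ≡ i ⊎ a ≡ suc i) × (b ≡ i ⊎ b ≡ suc i) × (c ≡ i ⊎ c ≡ suc i)

StarFree : (G : Graph) → (V G → ℕ) → Set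
StarFree G c = Proper G c ×
  (∀ u v w → u ≢ v → v ≢ w → u ≢ w → Adj G u v → Adj G v w →
     ¬ TwoConsecutive (c u) (c v) (c w))

StarFreeColoring : (G : Graph) → ℕ → Set
StarFreeColoring G t = Σ (V G → ℕ) λ c → StarFree G c × (∀ v → 1 ≤ c v × c v ≤ t)

IsStarFreeChromaticNumber : Graph → ℕ → Set
IsStarFreeChromaticNumber G t =
  1 ≤ t × StarFreeColoring G t × (∀ s → 1 ≤ s → StarFreeColoring G s → t ≤ s)

{-# OPTIONS --safe #-}
module Submission where

-- Adding an element costs two colours: all sets through it get a new colour that leaves a gap.
-- Conversely, let KG(n,k) be coloured with s colours. As χ_s(KG(n−1,k)) ≤ 2n − 4k, only
-- s ≤ 2n − 4k + 1 is at issue. If some class j has more than k C(n−2,k−2) + 1 members through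
-- an element x, then every k-set v avoiding x is disjoint from two of them, so v has none of
-- the colours j − 1, j, j + 1; deleting x and closing the gap saves two colours. Otherwise
-- every class is small: an intersecting family that is not a star is bounded, in the manner of
-- Hilton and Milner, through the cores below, and s such classes cannot exhaust all C(n,k)
-- vertices.

open import Defs
open import Data.Bool using (true; false)
open import Data.Empty renaming (⊥ to Absurd)
open import Data.Fin using (Fin; zero; suc; toℕ; fromℕ<)
open import Data.Fin.Properties using (any?; toℕ-fromℕ<; toℕ<n)
open import Data.Fin.Subset
  using (Subset; _∈_; _∉_; _⊆_; _∩_; _∪_; _─_; _-_; ∁; ⁅_⁆; ∣_∣; Empty; Nonempty)
  renaming (⊤ to full)
open import Data.Fin.Subset.Properties
open import Data.List using (List; []; _∷_; _++_; map; filter; length)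
open import Data.List.Properties using (filter-all; filter-none; filter-++; length-++; length-map)
import Data.List.Relation.Unary.All as All
open import Data.Nat using (ℕ; zero; suc; _+_; _*_; _^_; _≤_; _<_; _∸_; z≤n; s≤s;
  _≤?_; _<?_; _≟_; >-nonZero)
open import Data.Nat.Combinatorics using (_C_; nCk+nC[k+1]≡[n+1]C[k+1])
open import Data.Nat.Properties hiding (_≟_; _≤?_; _<?_)
open import Data.Nat.Tactic.RingSolver using (solve-∀)
open import Data.Product using (Σ; ∃; _×_; _,_; proj₁; proj₂)
open import Data.Sum using (_⊎_; inj₁; inj₂)
open import Data.Unit using (⊤; tt)
open import Data.Vec using ([]; _∷_; here; there; tabulate; insertAt; removeAt)
open import Data.Vec.Properties
  using ([]=⇒lookup; lookup⇒[]=; lookup∘tabulate; insertAt-lookup; removeAt-insertAt)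
open import Function using (_∘_; case_of_)
open import Level using (0ℓ)
open import Relation.Binary.PropositionalEquality
open import Relation.Nullary using (¬_; Dec; yes; no; does; ¬?; _×-dec_; contradiction)
open import Relation.Nullary.Decidable using (decidable-stable; dec-true)
open import Relation.Unary using (Pred; Decidable)

-- The cubic hypothesis comes from the final count. With c₂ = C(n-2,k-2) one has k(k-1) C(n,k) =
-- n(n-1) c₂, while 2n - 4k + 1 classes of about k c₂ members cover about (2n - 4k) k c₂ vertices.
-- This falls short once n + 2k exceeds roughly 2k²(k - 1), so the term -2k of the hypothesis is
-- earned by the -4k in the number of colours. The bound on a class that is not a star is a
-- trade-off. The core of x is the intersection of the members that avoid x. A large core leaves few
-- members that avoid x. A small core leaves few through x: one that misses the core has to meet two
-- members that avoid x, in two further elements, so there are at most k² C(n-3,k-3) of these, which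
-- is small beside c₂ for large n.

-- Counting list entries that satisfy a predicate.

module _ {A : Set} where

  count : {P : Pred A 0ℓ} → Decidable P → List A → ℕ
  count P? xs = length (filter P? xs)

  module _ {P Q : Pred A 0ℓ} (P? : Decidable P) (Q? : Decidable Q) where

    count-mono : (∀ x → P x → Q x) → ∀ xs → count P? xs ≤ count Q? xs
    count-mono P⇒Q [] = z≤n
    count-mono P⇒Q (x ∷ xs) with ih ← count-mono P⇒Q xs | P? x | Q? x
    ... | yes _ | yes _  = s≤s ih
    ... | yes p | no ¬q  = contradiction (P⇒Q x p) ¬q
    ... | no _  | yes _  = m≤n⇒m≤1+n ih
    ... | no _  | no _   = ih

  module _ {P Q R : Pred A 0ℓ} (P? : Decidable P) (Q? : Decidable Q) (R? : Decidable R) where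

    count-split : (∀ x → P x → Q x ⊎ R x) → ∀ xs → count P? xs ≤ count Q? xs + count R? xs
    count-split P⇒Q⊎R [] = z≤n
    count-split P⇒Q⊎R (x ∷ xs) with ih ← count-split P⇒Q⊎R xs | P? x | Q? x | R? x
    ... | no _  | no _  | no _  = ih
    ... | no _  | no _  | yes _ = ≤-trans ih (+-monoʳ-≤ (count Q? xs) (n≤1+n _))
    ... | no _  | yes _ | no _  = m≤n⇒m≤1+n ih
    ... | no _  | yes _ | yes _ = m≤n⇒m≤1+n (≤-trans ih (+-monoʳ-≤ (count Q? xs) (n≤1+n _)))
    ... | yes _ | yes _ | no _  = s≤s ih
    ... | yes _ | yes _ | yes _ = s≤s (≤-trans ih (+-monoʳ-≤ (count Q? xs) (n≤1+n _)))
    ... | yes _ | no _  | yes _ = ≤-trans (s≤s ih) (≤-reflexive (sym (+-suc (count Q? xs) _)))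
    ... | yes p | no ¬q | no ¬r with P⇒Q⊎R x p
    ...   | inj₁ q = contradiction q ¬q
    ...   | inj₂ r = contradiction r ¬r

  count-none : {P : Pred A 0ℓ} (P? : Decidable P) → (∀ x → ¬ P x) → ∀ xs → count P? xs ≡ 0
  count-none P? ¬P xs = cong length (filter-none P? (All.universal ¬P xs))

  count-witness : {P : Pred A 0ℓ} (P? : Decidable P) → ∀ xs → 1 ≤ count P? xs → ∃ P
  count-witness P? (x ∷ xs) 1≤ with P? x
  ... | yes p = x , p
  ... | no _  = count-witness P? xs 1≤

  count-++ : {P : Pred A 0ℓ} (P? : Decidable P) → ∀ xs ys →
             count P? (xs ++ ys) ≡ count P? xs + count P? ys
  count-++ P? xs ys = trans (cong length (filter-++ P? xs ys)) (length-++ (filter P? xs))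

  -- The union bound over the elements of `B`. Families of vertices are bounded below by covering
  -- them with the vertices through the elements of a suitable set.
  count-cover : ∀ {n} (B : Subset n) {P : Pred A 0ℓ} (P? : Decidable P)
                {Q : Fin n → Pred A 0ℓ} (Q? : ∀ b → Decidable (Q b)) m xs →
                (∀ x → P x → ∃ λ b → b ∈ B × Q b x) →
                (∀ b → b ∈ B → count (Q? b) xs ≤ m) →
                count P? xs ≤ ∣ B ∣ * m
  count-cover [] P? Q? m xs cover bound =
    ≤-reflexive (count-none P? (λ x p → case cover x p of λ { (() , _) }) xs)
  count-cover (false ∷ B) P? {Q} Q? m xs cover bound =
    count-cover B P? (Q? ∘ suc) m xs cover′ (λ b b∈ → bound (suc b) (there b∈))
    where
    cover′ : ∀ x → _ → ∃ λ b → b ∈ B × Q (suc b) x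
    cover′ x p with cover x p
    ... | suc b , there b∈ , q = b , b∈ , q
  count-cover (true ∷ B) {P} P? {Q} Q? m xs cover bound = begin
    count P? xs                        ≤⟨ count-split P? (Q? zero) P′? split xs ⟩
    count (Q? zero) xs + count P′? xs  ≤⟨ +-mono-≤ (bound zero here) rest ⟩
    m + ∣ B ∣ * m                      ∎
    where
    open ≤-Reasoning
    -- Dropping the entries that `Q zero` already counts makes every remaining witness a `suc b`, as
    -- the recursion requires.
    P′ : Pred A 0ℓ
    P′ x = P x × ¬ Q zero x
    P′? : Decidable P′
    P′? x = P? x ×-dec ¬? (Q? zero x)
    split : ∀ x → P x → Q zero x ⊎ P′ x
    split x p with Q? zero x
    ... | yes q = inj₁ q
    ... | no ¬q = inj₂ (p , ¬q)
    cover′ : ∀ x → P′ x → ∃ λ b → b ∈ B × Q (suc b) x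
    cover′ x (p , ¬q) with cover x p
    ... | zero  , _        , q = contradiction q ¬q
    ... | suc b , there b∈ , q = b , b∈ , q
    rest : count P′? xs ≤ ∣ B ∣ * m
    rest = count-cover B P′? (Q? ∘ suc) m xs cover′ (λ b b∈ → bound (suc b) (there b∈))

count-map : {A B : Set} (f : A → B) {P : Pred B 0ℓ} (P? : Decidable P) → ∀ xs →
            count P? (map f xs) ≡ count (P? ∘ f) xs
count-map f P? [] = refl
count-map f P? (x ∷ xs) with P? (f x)
... | yes _ = cong suc (count-map f P? xs)
... | no _  = count-map f P? xs

-- Kneser vertices and how many of them contain a given set.

Vertex : ℕ → ℕ → Set
Vertex n k = V (KG n k)

vertex-≡ : ∀ {n k} {u v : Vertex n k} → proj₁ u ≡ proj₁ v → u ≡ v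
vertex-≡ {u = S , e} {.S , e′} refl = cong (S ,_) (≡-irrelevant e e′)

with-zero : ∀ {n k} → Vertex n k → Vertex (suc n) (suc k)
with-zero (S , e) = true ∷ S , cong suc e

without-zero : ∀ {n k} → Vertex n k → Vertex (suc n) k
without-zero (S , e) = false ∷ S , e

-- The list enters the argument through its length and through upper bounds on the entries that
-- contain a given set; when that set is itself a vertex, the bound is one and excludes repetitions.
vertices : ∀ n k → List (Vertex n k)
vertices zero    zero    = ([] , refl) ∷ []
vertices zero    (suc k) = []
vertices (suc n) zero    = map without-zero (vertices n zero)
vertices (suc n) (suc k) =
  map with-zero (vertices n k) ++ map without-zero (vertices n (suc k))

length-vertices : ∀ n k → length (vertices n k) ≡ n C k
length-vertices zero    zero    = refl
length-vertices zero    (suc k) = refl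
length-vertices (suc n) zero    =
  trans (length-map without-zero (vertices n zero)) (length-vertices n zero)
length-vertices (suc n) (suc k) = begin
  length (map with-zero (vertices n k) ++ map without-zero (vertices n (suc k)))
    ≡⟨ length-++ (map with-zero (vertices n k)) ⟩
  length (map with-zero (vertices n k)) + length (map without-zero (vertices n (suc k)))
    ≡⟨ cong₂ _+_ (trans (length-map with-zero (vertices n k)) (length-vertices n k))
                 (trans (length-map without-zero (vertices n (suc k))) (length-vertices n (suc k))) ⟩
  n C k + n C suc k
    ≡⟨ nCk+nC[k+1]≡[n+1]C[k+1] n k ⟩
  suc n C suc k ∎
  where open ≡-Reasoning

-- The search runs over all subsets and not over `vertices`, so that a negative answer speaks of
-- every vertex.
anyVertex? : ∀ {n k} {P : Pred (Vertex n k) 0ℓ} → Decidable P → Dec (∃ P)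
anyVertex? {n} {k} {P} P? with anySubset? Q?
  where
  Q : Pred (Subset n) 0ℓ
  Q S = Σ (∣ S ∣ ≡ k) λ e → P (S , e)
  Q? : Decidable Q
  Q? S with ∣ S ∣ ≟ k
  ... | no ¬e = no (¬e ∘ proj₁)
  ... | yes e with P? (S , e)
  ...   | yes p = yes (e , p)
  ...   | no ¬p = no λ (e′ , p) → ¬p (subst P (vertex-≡ refl) p)
... | yes (S , e , p) = yes ((S , e) , p)
... | no ¬q           = no λ ((S , e) , p) → ¬q (S , e , p)

-- C(n − m, k − m) for m ≤ k, and 0 for m > k, where truncated subtraction would give C(n − m, 0).
supersets : ℕ → ℕ → ℕ → ℕ
supersets n       k       zero    = n C k
supersets (suc n) (suc k) (suc m) = supersets n k m
supersets _       _       (suc m) = 0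

supersets-suc : ∀ n m → supersets n 0 m ≤ supersets (suc n) 0 m
supersets-suc n zero    = ≤-refl
supersets-suc zero    (suc m) = z≤n
supersets-suc (suc n) (suc m) = z≤n

-- Pascal's rule, as an inequality because equality fails on a ground set that is too small:
-- `supersets 1 1 1` is 1, but `supersets 0 0 1 + supersets 0 1 1` is 0.
supersets-pascal : ∀ n k m →
  supersets n k m + supersets n (suc k) m ≤ supersets (suc n) (suc k) m
supersets-pascal n       k       zero    = ≤-reflexive (nCk+nC[k+1]≡[n+1]C[k+1] n k)
supersets-pascal zero    zero    (suc m) = z≤n
supersets-pascal zero    (suc k) (suc m) = z≤n
supersets-pascal (suc n) zero    (suc m) = supersets-suc n m
supersets-pascal (suc n) (suc k) (suc m) = supersets-pascal n k m

infix 4 _∈ᵥ_ _∈ᵥ?_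

_∈ᵥ_ : ∀ {n k} → Fin n → Vertex n k → Set
x ∈ᵥ v = x ∈ proj₁ v

_∈ᵥ?_ : ∀ {n k} (x : Fin n) (v : Vertex n k) → Dec (x ∈ᵥ v)
x ∈ᵥ? v = x ∈? proj₁ v

⊆ᵥ? : ∀ {n k} (T : Subset n) → Decidable (λ (v : Vertex n k) → T ⊆ proj₁ v)
⊆ᵥ? T v = T ⊆? proj₁ v

-- Induction on the ground set. If `T` contains the first element, only the half built by
-- `with-zero` counts; otherwise both halves count and Pascal's rule adds them.
count-supersets : ∀ {n} k (T : Subset n) → count (⊆ᵥ? T) (vertices n k) ≤ supersets n k ∣ T ∣
count-supersets-without-zero : ∀ {n} k (T : Subset n) →
  count (⊆ᵥ? (false ∷ T) ∘ without-zero) (vertices n k) ≤ supersets n k ∣ T ∣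

count-supersets-without-zero {n} k T =
  ≤-trans (count-mono _ (⊆ᵥ? T) (λ v → drop-∷-⊆) (vertices n k)) (count-supersets k T)

count-supersets zero    []      = ≤-refl
count-supersets (suc k) []      = z≤n
count-supersets {suc n} zero (t ∷ T)
  rewrite count-map without-zero (⊆ᵥ? (t ∷ T)) (vertices n zero) with t
... | true  = ≤-reflexive (count-none _ (λ v T⊆ → contradiction (T⊆ here) λ ()) (vertices n zero))
... | false = ≤-trans (count-supersets-without-zero zero T) (supersets-suc n ∣ T ∣)
count-supersets {suc n} (suc k) (t ∷ T)
  rewrite count-++ (⊆ᵥ? (t ∷ T)) (map with-zero (vertices n k)) (map without-zero (vertices n (suc k)))
        | count-map with-zero (⊆ᵥ? (t ∷ T)) (vertices n k)
        | count-map without-zero (⊆ᵥ? (t ∷ T)) (vertices n (suc k))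
  with with-zero-bound ←
    ≤-trans (count-mono (⊆ᵥ? (t ∷ T) ∘ with-zero) (⊆ᵥ? T) (λ v → drop-∷-⊆) (vertices n k))
            (count-supersets k T)
  with t
... | true  = ≤-trans
  (+-mono-≤ with-zero-bound
    (≤-reflexive (count-none _ (λ v T⊆ → contradiction (T⊆ here) λ ()) (vertices n (suc k)))))
  (≤-reflexive (+-identityʳ _))
... | false = ≤-trans (+-mono-≤ with-zero-bound (count-supersets-without-zero (suc k) T))
                      (supersets-pascal n k ∣ T ∣)

∣⁅x⁆∪p∣ : ∀ {n} {x : Fin n} (p : Subset n) → x ∉ p → ∣ ⁅ x ⁆ ∪ p ∣ ≡ suc ∣ p ∣
∣⁅x⁆∪p∣ {x = zero}  (true ∷ p)  x∉p = contradiction here x∉p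
∣⁅x⁆∪p∣ {x = zero}  (false ∷ p) x∉p = cong (suc ∘ ∣_∣) (∪-identityˡ p)
∣⁅x⁆∪p∣ {x = suc x} (true ∷ p)  x∉p = cong suc (∣⁅x⁆∪p∣ p (x∉p ∘ there))
∣⁅x⁆∪p∣ {x = suc x} (false ∷ p) x∉p = ∣⁅x⁆∪p∣ p (x∉p ∘ there)

∪-⊆ : ∀ {n} {p q r : Subset n} → p ⊆ r → q ⊆ r → p ∪ q ⊆ r
∪-⊆ {p = p} {q} p⊆r q⊆r x∈ with x∈p∪q⁻ p q x∈
... | inj₁ x∈p = p⊆r x∈p
... | inj₂ x∈q = q⊆r x∈q

⁅⁆-⊆ : ∀ {n} {x : Fin n} {p : Subset n} → x ∈ p → ⁅ x ⁆ ⊆ p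
⁅⁆-⊆ {x = x} {p} x∈p y∈ = subst (_∈ p) (sym (x∈⁅y⁆⇒x≡y x y∈)) x∈p

supersets-self : ∀ n k → supersets n k k ≤ 1
supersets-self n       zero    = ≤-refl
supersets-self zero    (suc k) = z≤n
supersets-self (suc n) (suc k) = supersets-self n k

module _ {n : ℕ} (k : ℕ) where

  contains-pair? : (x y : Fin n) → Decidable (λ (v : Vertex n k) → x ∈ᵥ v × y ∈ᵥ v)
  contains-pair? x y v = x ∈ᵥ? v ×-dec y ∈ᵥ? v

  contains-triple? : (x y z : Fin n) → Decidable (λ (v : Vertex n k) → x ∈ᵥ v × y ∈ᵥ v × z ∈ᵥ v)
  contains-triple? x y z v = x ∈ᵥ? v ×-dec y ∈ᵥ? v ×-dec z ∈ᵥ? v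

  count-pair : ∀ {x y} → x ≢ y → count (contains-pair? x y) (vertices n k) ≤ supersets n k 2
  count-pair {x} {y} x≢y = begin
    count (contains-pair? x y) (vertices n k)
      ≤⟨ count-mono (contains-pair? x y) (⊆ᵥ? (⁅ x ⁆ ∪ ⁅ y ⁆))
           (λ v (x∈ , y∈) → ∪-⊆ (⁅⁆-⊆ x∈) (⁅⁆-⊆ y∈)) (vertices n k) ⟩
    count (⊆ᵥ? (⁅ x ⁆ ∪ ⁅ y ⁆)) (vertices n k)
      ≤⟨ count-supersets k (⁅ x ⁆ ∪ ⁅ y ⁆) ⟩
    supersets n k ∣ ⁅ x ⁆ ∪ ⁅ y ⁆ ∣
      ≡⟨ cong (supersets n k) (trans (∣⁅x⁆∪p∣ ⁅ y ⁆ (x≢y⇒x∉⁅y⁆ x≢y)) (cong suc (∣⁅x⁆∣≡1 y))) ⟩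
    supersets n k 2 ∎
    where open ≤-Reasoning

  count-triple : ∀ {x y z} → x ≢ y → x ≢ z → y ≢ z →
    count (contains-triple? x y z) (vertices n k) ≤ supersets n k 3
  count-triple {x} {y} {z} x≢y x≢z y≢z = begin
    count (contains-triple? x y z) (vertices n k)
      ≤⟨ count-mono (contains-triple? x y z) (⊆ᵥ? T)
           (λ v (x∈ , y∈ , z∈) → ∪-⊆ (⁅⁆-⊆ x∈) (∪-⊆ (⁅⁆-⊆ y∈) (⁅⁆-⊆ z∈))) (vertices n k) ⟩
    count (⊆ᵥ? T) (vertices n k)
      ≤⟨ count-supersets k T ⟩
    supersets n k ∣ T ∣
      ≡⟨ cong (supersets n k) ∣T∣≡3 ⟩
    supersets n k 3 ∎
    where
    open ≤-Reasoning
    T : Subset n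
    T = ⁅ x ⁆ ∪ (⁅ y ⁆ ∪ ⁅ z ⁆)
    x∉ : x ∉ ⁅ y ⁆ ∪ ⁅ z ⁆
    x∉ x∈ with x∈p∪q⁻ ⁅ y ⁆ ⁅ z ⁆ x∈
    ... | inj₁ x∈y = x≢y (x∈⁅y⁆⇒x≡y y x∈y)
    ... | inj₂ x∈z = x≢z (x∈⁅y⁆⇒x≡y z x∈z)
    ∣T∣≡3 : ∣ T ∣ ≡ 3
    ∣T∣≡3 = trans (∣⁅x⁆∪p∣ _ x∉)
      (cong suc (trans (∣⁅x⁆∪p∣ ⁅ z ⁆ (x≢y⇒x∉⁅y⁆ y≢z)) (cong suc (∣⁅x⁆∣≡1 z))))

  -- Serves to find two different members of a colour class: among counted vertices, at most one
  -- contains `u`.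
  count-self : (u : Vertex n k) → count (⊆ᵥ? (proj₁ u)) (vertices n k) ≤ 1
  count-self (S , refl) = ≤-trans (count-supersets k S) (supersets-self n k)

-- Differences of subsets, choice of elements, comprehension.

x∈p─q⇒x∉q : ∀ {n} {x : Fin n} (p q : Subset n) → x ∈ p ─ q → x ∉ q
x∈p─q⇒x∉q (_ ∷ p) (true ∷ q)  (there x∈) (there x∈q) = x∈p─q⇒x∉q p q x∈ x∈q
x∈p─q⇒x∉q (_ ∷ p) (false ∷ q) (there x∈) (there x∈q) = x∈p─q⇒x∉q p q x∈ x∈q

∣p─q∣+∣q∣≡∣p∣ : ∀ {n} {p q : Subset n} → q ⊆ p → ∣ p ─ q ∣ + ∣ q ∣ ≡ ∣ p ∣
∣p─q∣+∣q∣≡∣p∣ {p = []}        {[]}        q⊆p = refl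
∣p─q∣+∣q∣≡∣p∣ {p = p₀ ∷ p}    {false ∷ q} q⊆p with p₀
... | true  = cong suc (∣p─q∣+∣q∣≡∣p∣ (drop-∷-⊆ q⊆p))
... | false = ∣p─q∣+∣q∣≡∣p∣ (drop-∷-⊆ q⊆p)
∣p─q∣+∣q∣≡∣p∣ {p = true ∷ p}  {true ∷ q}  q⊆p =
  trans (+-suc _ _) (cong suc (∣p─q∣+∣q∣≡∣p∣ (drop-∷-⊆ q⊆p)))
∣p─q∣+∣q∣≡∣p∣ {p = false ∷ p} {true ∷ q}  q⊆p = contradiction (q⊆p here) λ ()

pick : ∀ {n m} (p : Subset n) → suc m ≤ ∣ p ∣ → ∃ λ x → x ∈ p × m ≤ ∣ p - x ∣
pick (true ∷ p)  (s≤s m≤) = zero , here , subst (λ q → _ ≤ ∣ q ∣) (sym (p─⊥≡p p)) m≤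
pick (false ∷ p) m<       with pick p m<
... | x , x∈p , m≤ = suc x , there x∈p , m≤

pick-two : ∀ {n} (p : Subset n) → 2 ≤ ∣ p ∣ → ∃ λ x → ∃ λ y → x ∈ p × y ∈ p × x ≢ y
pick-two p 2≤ with pick p 2≤
... | x , x∈p , 1≤ with pick (p - x) 1≤
...   | y , y∈p-x , _ =
  x , y , x∈p , p─q⊆p p ⁅ x ⁆ y∈p-x , λ { refl → x∈p─q⇒x∉q p ⁅ x ⁆ y∈p-x (x∈⁅x⁆ x) }

pick-three : ∀ {n} (p : Subset n) → 3 ≤ ∣ p ∣ →
  ∃ λ x → ∃ λ y → ∃ λ z → (x ∈ p × y ∈ p × z ∈ p) × x ≢ y × x ≢ z × y ≢ z
pick-three p 3≤ with pick p 3≤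
... | x , x∈p , 2≤ with pick-two (p - x) 2≤
...   | y , z , y∈p-x , z∈p-x , y≢z =
  x , y , z , (x∈p , p─q⊆p p ⁅ x ⁆ y∈p-x , p─q⊆p p ⁅ x ⁆ z∈p-x) , x≢ y∈p-x , x≢ z∈p-x , y≢z
  where
  x≢ : ∀ {w} → w ∈ p - x → x ≢ w
  x≢ w∈p-x refl = x∈p─q⇒x∉q p ⁅ x ⁆ w∈p-x (x∈⁅x⁆ x)

module _ {n} {P : Pred (Fin n) 0ℓ} (P? : Decidable P) where

  subset : Subset n
  subset = tabulate (does ∘ P?)

  ∈-subset⁺ : ∀ {x} → P x → x ∈ subset
  ∈-subset⁺ {x} p =
    lookup⇒[]= x subset (trans (lookup∘tabulate (does ∘ P?) x) (dec-true (P? x) p))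

  ∈-subset⁻ : ∀ {x} → x ∈ subset → P x
  ∈-subset⁻ {x} x∈ with P? x | trans (sym (lookup∘tabulate (does ∘ P?) x)) ([]=⇒lookup x∈)
  ... | yes p | _ = p

-- Intersecting families and their cores.

module Family {n k} {F : Pred (Vertex n k) 0ℓ} (F? : Decidable F) where

  size : ℕ
  size = count F? (vertices n k)

  through? : ∀ x → Decidable (λ v → F v × x ∈ᵥ v)
  through? x v = F? v ×-dec x ∈ᵥ? v

  avoiding? : ∀ x → Decidable (λ v → F v × x ∉ proj₁ v)
  avoiding? x v = F? v ×-dec ¬? (x ∈ᵥ? v)

  degree : Fin n → ℕ
  degree x = count (through? x) (vertices n k)

  in-core? : ∀ x → Decidable (λ y → ¬ ∃ λ v → (F v × x ∉ proj₁ v) × y ∉ proj₁ v)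
  in-core? x y = ¬? (anyVertex? λ v → avoiding? x v ×-dec ¬? (y ∈ᵥ? v))

  -- The intersection of all members of the family that avoid x.
  core : Fin n → Subset n
  core x = subset (in-core? x)

  ∈-core : ∀ {x y v} → y ∈ core x → F v → x ∉ proj₁ v → y ∈ᵥ v
  ∈-core {x} {y} {v} y∈ Fv x∉v = decidable-stable (y ∈ᵥ? v) λ y∉v →
    ∈-subset⁻ (in-core? x) y∈ (v , (Fv , x∉v) , y∉v)

  ∉-core : ∀ {x y} → y ∉ core x → ∃ λ v → (F v × x ∉ proj₁ v) × y ∉ proj₁ v
  ∉-core {x} {y} y∉ with anyVertex? (λ v → avoiding? x v ×-dec ¬? (y ∈ᵥ? v))
  ... | yes w = w
  ... | no ¬w = contradiction (∈-subset⁺ (in-core? x) ¬w) y∉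

  size-split : ∀ x → size ≤ degree x + count (avoiding? x) (vertices n k)
  size-split x = count-split F? (through? x) (avoiding? x) split (vertices n k)
    where
    split : ∀ v → F v → (F v × x ∈ᵥ v) ⊎ (F v × x ∉ proj₁ v)
    split v Fv with x ∈ᵥ? v
    ... | yes x∈v = inj₁ (Fv , x∈v)
    ... | no x∉v  = inj₂ (Fv , x∉v)

  core-size : ∀ {x v} → F v → x ∉ proj₁ v → ∣ proj₁ v ─ core x ∣ ≡ k ∸ ∣ core x ∣
  core-size {x} {v} Fv x∉v = begin
    ∣ proj₁ v ─ core x ∣                             ≡⟨ m+n∸n≡m _ ∣ core x ∣ ⟨
    ∣ proj₁ v ─ core x ∣ + ∣ core x ∣ ∸ ∣ core x ∣
      ≡⟨ cong (_∸ ∣ core x ∣) (∣p─q∣+∣q∣≡∣p∣ (λ y∈ → ∈-core y∈ Fv x∉v)) ⟩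
    ∣ proj₁ v ∣ ∸ ∣ core x ∣                         ≡⟨ cong (_∸ ∣ core x ∣) (proj₂ v) ⟩
    k ∸ ∣ core x ∣                                   ∎
    where open ≡-Reasoning

  -- Without a member that avoids `x` the core would be the whole ground set; given one, the core
  -- lies inside it.
  core-≤ : ∀ {x v} → F v → x ∉ proj₁ v → ∣ core x ∣ ≤ k
  core-≤ {x} {v} Fv x∉v =
    ≤-trans (p⊆q⇒∣p∣≤∣q∣ (λ y∈ → ∈-core y∈ Fv x∉v)) (≤-reflexive (proj₂ v))

  module _ (intersecting : ∀ u v → F u → F v → Nonempty (proj₁ u ∩ proj₁ v)) where

    common : ∀ {u v} → F u → F v → ∃ λ y → y ∈ᵥ u × y ∈ᵥ v
    common {u} {v} Fu Fv with intersecting u v Fu Fv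
    ... | y , y∈ = y , x∈p∩q⁻ (proj₁ u) (proj₁ v) y∈

    -- A member through x that misses core x meets a fixed v avoiding x in some b ∉ core x,
    -- and then a member that avoids both x and b in some b′.
    degree-core : ∀ {x v} → F v → x ∉ proj₁ v →
      degree x ≤ ∣ core x ∣ * supersets n k 2 +
                 (k ∸ ∣ core x ∣) * ((k ∸ ∣ core x ∣) * supersets n k 3)
    degree-core {x} {v} Fv x∉v = ≤-trans
      (count-split (through? x) meeting? missing? split (vertices n k))
      (+-mono-≤ meeting-bound missing-bound)
      where
      r = k ∸ ∣ core x ∣
      meeting? : Decidable (λ u → (F u × x ∈ᵥ u) × Nonempty (core x ∩ proj₁ u))
      meeting? u = through? x u ×-dec nonempty? (core x ∩ proj₁ u)
      missing? : Decidable (λ u → (F u × x ∈ᵥ u) × Empty (core x ∩ proj₁ u))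
      missing? u = through? x u ×-dec ¬? (nonempty? (core x ∩ proj₁ u))
      missing-at? : ∀ b → Decidable (λ u → ((F u × x ∈ᵥ u) × Empty (core x ∩ proj₁ u)) × b ∈ᵥ u)
      missing-at? b u = missing? u ×-dec b ∈ᵥ? u
      split : ∀ u → F u × x ∈ᵥ u →
              ((F u × x ∈ᵥ u) × Nonempty (core x ∩ proj₁ u)) ⊎
              ((F u × x ∈ᵥ u) × Empty (core x ∩ proj₁ u))
      split u Fxu with nonempty? (core x ∩ proj₁ u)
      ... | yes ne = inj₁ (Fxu , ne)
      ... | no e   = inj₂ (Fxu , e)
      meeting-bound : count meeting? (vertices n k) ≤ ∣ core x ∣ * supersets n k 2
      meeting-bound = count-cover (core x) meeting? (contains-pair? k x) _ (vertices n k)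
        (λ u ((_ , x∈u) , y , y∈) →
           y , proj₁ (x∈p∩q⁻ (core x) (proj₁ u) y∈) , x∈u , proj₂ (x∈p∩q⁻ (core x) (proj₁ u) y∈))
        (λ y y∈ → count-pair {n} k λ { refl → x∉v (∈-core y∈ Fv x∉v) })
      outside-core : ∀ {u w} → F u → Empty (core x ∩ proj₁ u) → F w →
                     ∃ λ b → b ∈ proj₁ w ─ core x × b ∈ᵥ u
      outside-core {u} {w} Fu e Fw with common {u} {w} Fu Fw
      ... | b , b∈u , b∈w = b , x∈p∧x∉q⇒x∈p─q b∈w (λ b∈core → e (b , x∈p∩q⁺ (b∈core , b∈u))) , b∈u
      missing-at-bound : ∀ b → b ∈ proj₁ v ─ core x →
                         count (missing-at? b) (vertices n k) ≤ r * supersets n k 3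
      missing-at-bound b b∈ with ∉-core (x∈p─q⇒x∉q (proj₁ v) (core x) b∈)
      ... | w , (Fw , x∉w) , b∉w = subst
        (λ m → count (missing-at? b) (vertices n k) ≤ m * supersets n k 3) (core-size {v = w} Fw x∉w)
        (count-cover (proj₁ w ─ core x) (missing-at? b) (contains-triple? k x b) _ (vertices n k)
          cover λ b′ b′∈ → count-triple {n} k
            (λ { refl → x∉v (p─q⊆p (proj₁ v) (core x) b∈) })
            (λ { refl → x∉w (p─q⊆p (proj₁ w) (core x) b′∈) })
            (λ { refl → b∉w (p─q⊆p (proj₁ w) (core x) b′∈) }))
        where
        cover : ∀ u → ((F u × x ∈ᵥ u) × Empty (core x ∩ proj₁ u)) × b ∈ᵥ u →
                ∃ λ b′ → b′ ∈ proj₁ w ─ core x × x ∈ᵥ u × b ∈ᵥ u × b′ ∈ᵥ u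
        cover u (((Fu , x∈u) , e) , b∈u) with outside-core {u} {w} Fu e Fw
        ... | b′ , b′∈ , b′∈u = b′ , b′∈ , x∈u , b∈u , b′∈u
      missing-bound : count missing? (vertices n k) ≤ r * (r * supersets n k 3)
      missing-bound = subst
        (λ m → count missing? (vertices n k) ≤ m * (r * supersets n k 3)) (core-size {v = v} Fv x∉v)
        (count-cover (proj₁ v ─ core x) missing? missing-at? _ (vertices n k) cover missing-at-bound)
        where
        cover : ∀ u → (F u × x ∈ᵥ u) × Empty (core x ∩ proj₁ u) →
                ∃ λ b → b ∈ proj₁ v ─ core x × ((F u × x ∈ᵥ u) × Empty (core x ∩ proj₁ u)) × b ∈ᵥ u
        cover u m@((Fu , x∈u) , e) with outside-core {u} {v} Fu e Fv
        ... | b , b∈ , b∈u = b , b∈ , m , b∈u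

    avoiding-pair : ∀ x → 2 ≤ ∣ core x ∣ → count (avoiding? x) (vertices n k) ≤ supersets n k 2
    avoiding-pair x 2≤ with pick-two (core x) 2≤
    ... | y , z , y∈ , z∈ , y≢z = ≤-trans
      (count-mono (avoiding? x) (contains-pair? k y z)
        (λ v (Fv , x∉v) → ∈-core y∈ Fv x∉v , ∈-core z∈ Fv x∉v) (vertices n k))
      (count-pair {n} k y≢z)

    avoiding-triple : ∀ x → 3 ≤ ∣ core x ∣ → count (avoiding? x) (vertices n k) ≤ supersets n k 3
    avoiding-triple x 3≤ with pick-three (core x) 3≤
    ... | w , y , z , (w∈ , y∈ , z∈) , w≢y , w≢z , y≢z = ≤-trans
      (count-mono (avoiding? x) (contains-triple? k w y z)
        (λ v (Fv , x∉v) → ∈-core w∈ Fv x∉v , ∈-core y∈ Fv x∉v , ∈-core z∈ Fv x∉v) (vertices n k))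
      (count-triple {n} k w≢y w≢z y≢z)

    -- Stars aside, the cases follow the largest core. Size at least 3 leaves at most c₃ members
    -- that avoid `x`, size 2 at most c₂. If all cores have size at most 1 and `y` lies in `core x`,
    -- every member contains `x` or `y`, both of small degree. If all cores are empty, every member
    -- meets a fixed one in one of its `k` elements, each of degree at most k² c₃.
    size-≤ : ∀ {M} (let c₂ = supersets n k 2; c₃ = supersets n k 3) → Fin n →
      (∀ x → degree x ≤ M) →
      (∀ p → p ≤ k → p * c₂ + (k ∸ p) * ((k ∸ p) * c₃) + c₃ ≤ M) →
      2 * c₂ + (k ∸ 2) * ((k ∸ 2) * c₃) + c₂ ≤ M →
      2 * (c₂ + k * (k * c₃)) ≤ M →
      k * (k * (k * c₃)) ≤ M →
      size ≤ M
    size-≤ {M} x₀ star≤ large≤ two≤ one≤ none≤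
      with any? (λ x → ¬? (anyVertex? (avoiding? x)))
    ... | yes (x , ¬avoided) = ≤-trans
      (count-mono F? (through? x)
        (λ v Fv → Fv , decidable-stable (x ∈ᵥ? v) (λ x∉v → ¬avoided (v , Fv , x∉v))) (vertices n k))
      (star≤ x)
    ... | no all-avoided = nontrivial
      where
      avoider : ∀ x → ∃ λ v → F v × x ∉ proj₁ v
      avoider x with anyVertex? (avoiding? x)
      ... | yes w = w
      ... | no ¬w = contradiction (x , ¬w) all-avoided
      degree-≤ : ∀ x → degree x ≤ ∣ core x ∣ * supersets n k 2 +
                   (k ∸ ∣ core x ∣) * ((k ∸ ∣ core x ∣) * supersets n k 3)
      degree-≤ x with avoider x
      ... | v , Fv , x∉v = degree-core {v = v} Fv x∉v
      nontrivial : size ≤ M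
      nontrivial
        with any? (λ x → 3 ≤? ∣ core x ∣) | any? (λ x → ∣ core x ∣ ≟ 2) | any? (λ x → 1 ≤? ∣ core x ∣)
      ... | yes (x , 3≤) | _ | _ = ≤-trans (size-split x)
        (≤-trans (+-mono-≤ (degree-≤ x) (avoiding-triple x 3≤)) (large≤ ∣ core x ∣ core≤k))
        where
        core≤k : ∣ core x ∣ ≤ k
        core≤k with avoider x
        ... | v , Fv , x∉v = core-≤ {v = v} Fv x∉v
      ... | no _ | yes (x , ≡2) | _ = ≤-trans (size-split x) (≤-trans
        (+-mono-≤ (degree-≤ x) (avoiding-pair x (≤-reflexive (sym ≡2))))
        (subst (λ p → p * supersets n k 2 + (k ∸ p) * ((k ∸ p) * supersets n k 3) + supersets n k 2 ≤ M)
          (sym ≡2) two≤))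
      ... | no ≱3 | no ≢2 | yes (x , 1≤) with pick (core x) 1≤
      ...   | y , y∈ , _ = ≤-trans
        (count-split F? (through? x) (through? y) split (vertices n k))
        (≤-trans (+-mono-≤ (small x) (small y))
          (≤-trans (≤-reflexive (cong (bound +_) (sym (+-identityʳ bound)))) one≤))
        where
        bound = supersets n k 2 + k * (k * supersets n k 3)
        split : ∀ v → F v → (F v × x ∈ᵥ v) ⊎ (F v × y ∈ᵥ v)
        split v Fv with x ∈ᵥ? v
        ... | yes x∈v = inj₁ (Fv , x∈v)
        ... | no x∉v  = inj₂ (Fv , ∈-core y∈ Fv x∉v)
        core≤1 : ∀ z → ∣ core z ∣ ≤ 1
        core≤1 z = ≤-pred (≤∧≢⇒< (≤-pred (≰⇒> (λ 3≤ → ≱3 (z , 3≤)))) (λ ≡2 → ≢2 (z , ≡2)))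
        small : ∀ z → degree z ≤ bound
        small z = ≤-trans (degree-≤ z) (+-mono-≤
          (≤-trans (*-monoˡ-≤ _ (core≤1 z)) (≤-reflexive (*-identityˡ _)))
          (*-mono-≤ (m∸n≤m k ∣ core z ∣) (*-monoˡ-≤ _ (m∸n≤m k ∣ core z ∣))))
      -- Any member will do as `v`; the element `x₀` yields one, because no element lies in all
      -- members.
      nontrivial | no _ | no _ | no ≱1 with avoider x₀
      ...   | v , Fv , _ = ≤-trans
        (subst (λ m → size ≤ m * (k * (k * supersets n k 3))) (proj₂ v)
          (count-cover (proj₁ v) F? through? _ (vertices n k) cover (λ b _ → small b)))
        none≤
        where
        cover : ∀ u → F u → ∃ λ b → b ∈ᵥ v × F u × b ∈ᵥ u
        cover u Fu with common {u} {v} Fu Fv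
        ... | b , b∈u , b∈v = b , b∈v , Fu , b∈u
        small : ∀ z → degree z ≤ k * (k * supersets n k 3)
        small z with ∣ core z ∣ | degree-≤ z | ≰⇒> (λ 1≤ → ≱1 (z , 1≤))
        ... | zero | d≤ | _ = d≤
        ... | suc _ | _ | s≤s ()

-- Binomial estimates.

-- Pairs of a set and one of its elements, counted in two ways. This lets C(n,k), c₂ and c₃ be
-- compared by cross-multiplication, without division.
C-absorption : ∀ n k → suc k * (suc n C suc k) ≡ suc n * (n C k)
C-absorption zero    zero    = refl
C-absorption zero    (suc k) = *-zeroʳ k
C-absorption (suc n) zero    = begin
  1 * (suc (suc n) C 1)           ≡⟨ cong (1 *_) (nCk+nC[k+1]≡[n+1]C[k+1] (suc n) 0) ⟨
  1 * (suc n C 0 + suc n C 1)     ≡⟨ cong (λ c → 1 * (1 + c)) (trans (sym (*-identityˡ _)) (C-absorption n zero)) ⟩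
  1 * (1 + suc n * 1)             ≡⟨ identity n ⟩
  suc (suc n) * 1                 ∎
  where
  open ≡-Reasoning
  identity : ∀ n → 1 * (1 + suc n * 1) ≡ suc (suc n) * 1
  identity = solve-∀
C-absorption (suc n) (suc k) = begin
  suc (suc k) * (suc (suc n) C suc (suc k))
    ≡⟨ cong (suc (suc k) *_) (nCk+nC[k+1]≡[n+1]C[k+1] (suc n) (suc k)) ⟨
  suc (suc k) * (suc n C suc k + suc n C suc (suc k))
    ≡⟨ *-distribˡ-+ (suc (suc k)) (suc n C suc k) (suc n C suc (suc k)) ⟩
  (suc n C suc k + suc k * (suc n C suc k)) + suc (suc k) * (suc n C suc (suc k))
    ≡⟨ cong₂ (λ a b → (suc n C suc k + a) + b) (C-absorption n k) (C-absorption n (suc k)) ⟩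
  (suc n C suc k + suc n * (n C k)) + suc n * (n C suc k)
    ≡⟨ +-assoc (suc n C suc k) _ _ ⟩
  suc n C suc k + (suc n * (n C k) + suc n * (n C suc k))
    ≡⟨ cong (suc n C suc k +_) (*-distribˡ-+ (suc n) (n C k) (n C suc k)) ⟨
  suc n C suc k + suc n * (n C k + n C suc k)
    ≡⟨ cong (λ c → suc n C suc k + suc n * c) (nCk+nC[k+1]≡[n+1]C[k+1] n k) ⟩
  suc (suc n) * (suc n C suc k) ∎
  where open ≡-Reasoning

C-positive : ∀ {n k} → k ≤ n → 1 ≤ n C k
C-positive {n}     {zero}  _         = ≤-refl
C-positive {suc n} {suc k} (s≤s k≤n) = begin
  1                  ≤⟨ C-positive k≤n ⟩
  n C k              ≤⟨ m≤m+n _ _ ⟩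
  n C k + n C suc k  ≡⟨ nCk+nC[k+1]≡[n+1]C[k+1] n k ⟩
  suc n C suc k      ∎
  where open ≤-Reasoning

≤-from-+ : ∀ {m n} d → m + d ≡ n → m ≤ n
≤-from-+ {m} d refl = m≤m+n m d

-- One bound for both kinds of class: k c₂ + 1 is left to a star whose centre is below the
-- popularity threshold, and k c₂ + c₃ is the estimate for a family with a core of size `k`.
familyBound : ℕ → ℕ → ℕ
familyBound n k = k * supersets n k 2 + supersets n k 3 + 1

-- The case k = 3 + q, with m = n - 2 and m₁ = n - 3. The polynomial is 2k³ - 2k² - 2k + 4 expanded
-- in `q`, less 3, and `e` is the excess of n over the hypothesis. In these variables each
-- inequality is a polynomial identity whose slack has nonnegative coefficients.
module LargeK (q e m₁ : ℕ) (m₁≡ : m₁ ≡ 31 + 40 * q + 16 * (q * q) + 2 * (q * (q * q)) + e) where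

  k m n c₂ c₃ : ℕ
  k  = 3 + q
  m  = suc m₁
  n  = 2 + m
  c₂ = supersets n k 2
  c₃ = supersets n k 3

  c₃-absorption : suc q * c₂ ≡ m * c₃
  c₃-absorption = C-absorption m₁ q

  c₂-absorption : k * ((2 + q) * (n C k)) ≡ n * ((1 + m) * c₂)
  c₂-absorption = begin
    k * ((2 + q) * (n C k))           ≡⟨ swap k (2 + q) (n C k) ⟩
    (2 + q) * (k * (n C k))           ≡⟨ cong ((2 + q) *_) (C-absorption (suc m) (suc (suc q))) ⟩
    (2 + q) * (n * (suc m C suc (suc q))) ≡⟨ swap (2 + q) n (suc m C suc (suc q)) ⟩
    n * ((2 + q) * (suc m C suc (suc q))) ≡⟨ cong (n *_) (C-absorption m (suc q)) ⟩
    n * ((1 + m) * c₂)                ∎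
    where
    open ≡-Reasoning
    swap : ∀ a b c → a * (b * c) ≡ b * (a * c)
    swap = solve-∀

  q≤m₁ : q ≤ m₁
  q≤m₁ = ≤-from-+ (31 + 39 * q + 16 * (q * q) + 2 * (q * (q * q)) + e) (trans (identity q e) (sym m₁≡))
    where
    identity : ∀ q e → q + (31 + 39 * q + 16 * (q * q) + 2 * (q * (q * q)) + e) ≡
                       31 + 40 * q + 16 * (q * q) + 2 * (q * (q * q)) + e
    identity = solve-∀

  1≤c₂ : 1 ≤ c₂
  1≤c₂ = C-positive (s≤s q≤m₁)

  1≤c₃ : 1 ≤ c₃
  1≤c₃ = C-positive q≤m₁

  -- By absorption c₂ : c₃ = (n - 2) : (k - 2), and n - 2 is at least 2k²(k - 2).
  2k²c₃≤c₂ : 2 * (k * (k * c₃)) ≤ c₂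
  2k²c₃≤c₂ = *-cancelˡ-≤ (suc q) (begin
    suc q * (2 * (k * (k * c₃)))  ≡⟨ regroup q c₃ ⟩
    suc q * (2 * (k * k)) * c₃    ≤⟨ *-monoˡ-≤ c₃ 2k²[k-2]≤m ⟩
    m * c₃                        ≡⟨ c₃-absorption ⟨
    suc q * c₂                    ∎)
    where
    open ≤-Reasoning
    regroup : ∀ q c → suc q * (2 * ((3 + q) * ((3 + q) * c))) ≡ suc q * (2 * ((3 + q) * (3 + q))) * c
    regroup = solve-∀
    identity : ∀ q e → suc q * (2 * ((3 + q) * (3 + q))) + (14 + 10 * q + 2 * (q * q) + e) ≡
                       suc (31 + 40 * q + 16 * (q * q) + 2 * (q * (q * q)) + e)
    identity = solve-∀
    2k²[k-2]≤m : suc q * (2 * (k * k)) ≤ m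
    2k²[k-2]≤m = ≤-from-+ (14 + 10 * q + 2 * (q * q) + e) (trans (identity q e) (cong suc (sym m₁≡)))

  -- Since (k - 2)² = 1 + (k - 3)(k - 1) and (k - 1) c₃ ≤ c₂, the square costs c₃ and k - 3 further
  -- copies of c₂, added to the three already there.
  2≤k-bound : 2 * c₂ + suc q * (suc q * c₃) + c₂ ≤ k * c₂ + c₃
  2≤k-bound = begin
    2 * c₂ + suc q * (suc q * c₃) + c₂          ≡⟨ regroup q c₂ c₃ ⟩
    3 * c₂ + c₃ + q * ((2 + q) * c₃)            ≤⟨ +-monoʳ-≤ (3 * c₂ + c₃) (*-monoʳ-≤ q [2+q]c₃≤c₂) ⟩
    3 * c₂ + c₃ + q * c₂                        ≡⟨ regroup′ q c₂ c₃ ⟩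
    k * c₂ + c₃                                 ∎
    where
    open ≤-Reasoning
    regroup : ∀ q a b → 2 * a + suc q * (suc q * b) + a ≡ 3 * a + b + q * ((2 + q) * b)
    regroup = solve-∀
    regroup′ : ∀ q a b → 3 * a + b + q * a ≡ (3 + q) * a + b
    regroup′ = solve-∀
    identity : ∀ q b → (2 + q) * b + (16 + 11 * q + 2 * (q * q)) * b ≡ 2 * ((3 + q) * ((3 + q) * b))
    identity = solve-∀
    [2+q]c₃≤c₂ : (2 + q) * c₃ ≤ c₂
    [2+q]c₃≤c₂ = ≤-trans (≤-from-+ ((16 + 11 * q + 2 * (q * q)) * c₃) (identity q c₃)) 2k²c₃≤c₂

  -- k (k − 1) (k m + 2 (k − 2)), with m = n − 2, is what the absorption identities turn
  -- k (k − 1) m · (k c₂ + 2 c₃) / c₂ into.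
  weight : ℕ
  weight = k * ((2 + q) * (k * m + 2 * suc q))

  -- The hypothesis on n reads m + 2k ≥ 2k²(k - 1) + 2. Multiplied by `m`, its first term is the
  -- leading term of `2 * weight`, and the 2m left over covers the remaining 4k(k - 1)(k - 2).
  weight-≤ : 2 * weight ≤ m * (m + 2 * k)
  weight-≤ = ≤-from-+ (e * m + (40 + 36 * q + 8 * (q * q) + 2 * e)) identity′
    where
    identity : ∀ q e → let m = suc (31 + 40 * q + 16 * (q * q) + 2 * (q * (q * q)) + e) in
      2 * ((3 + q) * ((2 + q) * ((3 + q) * m + 2 * suc q))) +
        (e * m + (40 + 36 * q + 8 * (q * q) + 2 * e)) ≡ m * (m + 2 * (3 + q))
    identity = solve-∀
    identity′ : 2 * weight + (e * m + (40 + 36 * q + 8 * (q * q) + 2 * e)) ≡ m * (m + 2 * k)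
    identity′ rewrite m₁≡ = identity q e

  -- With s at most 2m + 5 - 4k, the factor m + 2k makes the terms in km cancel: 2m² + 5m + 10k -
  -- 8k² stands against 2m² + 6m + 4. Adding 4k(m + 2k) to both sides avoids subtraction.
  colours-≤ : ∀ s → s + 4 * k ≤ 2 * n + 1 → s * (m + 2 * k) < 2 * (n * (1 + m))
  colours-≤ s s≤ = +-cancelʳ-≤ (4 * k * (m + 2 * k)) _ _ (begin
    suc (s * (m + 2 * k)) + 4 * k * (m + 2 * k)   ≡⟨ cong suc (*-distribʳ-+ (m + 2 * k) s (4 * k)) ⟨
    suc ((s + 4 * k) * (m + 2 * k))               ≤⟨ s≤s (*-monoˡ-≤ (m + 2 * k) s≤) ⟩
    suc ((2 * n + 1) * (m + 2 * k))               ≤⟨ ≤-from-+ (m + 45 + 38 * q + 8 * (q * q)) (identity m q) ⟩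
    2 * (n * (1 + m)) + 4 * k * (m + 2 * k)       ∎)
    where
    open ≤-Reasoning
    identity : ∀ m q → suc ((2 * (2 + m) + 1) * (m + 2 * (3 + q))) +
                        (m + 45 + 38 * q + 8 * (q * q)) ≡
                       2 * ((2 + m) * (1 + m)) + 4 * (3 + q) * (m + 2 * (3 + q))
    identity = solve-∀

  -- Multiplied by 2mk(k - 1), both sides become multiples of c₂. Then `weight-≤` introduces the
  -- factor m + 2k, and `colours-≤` trades it, together with `s`, for 2n(n - 1).
  too-few-colours : ∀ s → s + 4 * k ≤ 2 * n + 1 → s * familyBound n k < n C k
  too-few-colours s s≤ = *-cancelˡ-< (2 * (m * (k * (2 + q)))) _ _ (begin-strict
    2 * (m * (k * (2 + q))) * (s * (k * c₂ + c₃ + 1))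
      -- The summand 1 is absorbed into a second `c₃`, which is positive as k ≥ 3.
      ≤⟨ *-monoʳ-≤ (2 * (m * (k * (2 + q)))) (*-monoʳ-≤ s double-c₃) ⟩
    2 * (m * (k * (2 + q))) * (s * (k * c₂ + 2 * c₃))
      ≡⟨ regroup m k q s c₂ c₃ ⟩
    2 * (k * (2 + q)) * s * (k * m * c₂ + 2 * (m * c₃))
      ≡⟨ cong (λ z → 2 * (k * (2 + q)) * s * (k * m * c₂ + 2 * z)) c₃-absorption ⟨
    2 * (k * (2 + q)) * s * (k * m * c₂ + 2 * (suc q * c₂))
      ≡⟨ regroup′ m k q s c₂ ⟩
    s * (2 * weight) * c₂
      ≤⟨ *-monoˡ-≤ c₂ (*-monoʳ-≤ s weight-≤) ⟩
    s * (m * (m + 2 * k)) * c₂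
      ≡⟨ regroup″ s m (m + 2 * k) c₂ ⟩
    s * (m + 2 * k) * (m * c₂)
      <⟨ *-monoˡ-< (m * c₂) {{>-nonZero (*-mono-≤ {1} {m} {1} {c₂} (s≤s z≤n) 1≤c₂)}} (colours-≤ s s≤) ⟩
    2 * (n * (1 + m)) * (m * c₂)
      ≡⟨ regroup‴ n (1 + m) m c₂ ⟩
    2 * m * (n * ((1 + m) * c₂))
      ≡⟨ cong (2 * m *_) c₂-absorption ⟨
    2 * m * (k * ((2 + q) * (n C k)))
      ≡⟨ regroup⁗ m k (2 + q) (n C k) ⟩
    2 * (m * (k * (2 + q))) * (n C k) ∎)
    where
    open ≤-Reasoning
    double-c₃ : k * c₂ + c₃ + 1 ≤ k * c₂ + 2 * c₃
    double-c₃ = ≤-trans (≤-reflexive (+-assoc (k * c₂) c₃ 1)) (+-monoʳ-≤ (k * c₂)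
      (+-monoʳ-≤ c₃ (≤-trans 1≤c₃ (≤-reflexive (sym (+-identityʳ c₃))))))
    regroup : ∀ m k q s a b → 2 * (m * (k * (2 + q))) * (s * (k * a + 2 * b)) ≡
                              2 * (k * (2 + q)) * s * (k * m * a + 2 * (m * b))
    regroup = solve-∀
    regroup′ : ∀ m k q s a → 2 * (k * (2 + q)) * s * (k * m * a + 2 * (suc q * a)) ≡
                             s * (2 * (k * ((2 + q) * (k * m + 2 * suc q)))) * a
    regroup′ = solve-∀
    regroup″ : ∀ s m x a → s * (m * x) * a ≡ s * x * (m * a)
    regroup″ = solve-∀
    regroup‴ : ∀ n x m a → 2 * (n * x) * (m * a) ≡ 2 * m * (n * (x * a))
    regroup‴ = solve-∀
    regroup⁗ : ∀ m k x a → 2 * m * (k * (x * a)) ≡ 2 * (m * (k * x)) * a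
    regroup⁗ = solve-∀
-- The numerical facts that the count draws on, collected because k = 2 has to be treated apart:
-- there c₃ = 0 and cannot absorb the summand 1.
record LargeGround (n k : ℕ) : Set where
  c₂ = supersets n k 2
  c₃ = supersets n k 3
  field
    triples : 2 * (k * (k * c₃)) ≤ c₂
    core-2  : 2 * c₂ + (k ∸ 2) * ((k ∸ 2) * c₃) + c₂ ≤ familyBound n k
    core-1  : 2 * (c₂ + k * (k * c₃)) ≤ familyBound n k
    colours : ∀ s → s + 4 * k ≤ 2 * n + 1 → s * familyBound n k < n C k

  k²c₃≤c₂ : k * (k * c₃) ≤ c₂
  k²c₃≤c₂ = ≤-trans (m≤m+n _ _) triples

  kc₂≤bound : k * c₂ + c₃ ≤ familyBound n k
  kc₂≤bound = m≤m+n _ 1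

  core-0 : k * (k * (k * c₃)) ≤ familyBound n k
  core-0 = ≤-trans (*-monoʳ-≤ k k²c₃≤c₂) (≤-trans (m≤m+n (k * c₂) c₃) kc₂≤bound)

  -- A core of size k is the worst case: each element missing from it saves one c₂, and (k - p)² c₃
  -- is at most (k - p) c₂.
  core-≤k : ∀ p → p ≤ k → p * c₂ + (k ∸ p) * ((k ∸ p) * c₃) + c₃ ≤ familyBound n k
  core-≤k p p≤k = begin
    p * c₂ + r * (r * c₃) + c₃   ≤⟨ +-monoˡ-≤ c₃ (+-monoʳ-≤ (p * c₂) (*-monoʳ-≤ r rc₃≤c₂)) ⟩
    p * c₂ + r * c₂ + c₃         ≡⟨ cong (_+ c₃) (*-distribʳ-+ c₂ p r) ⟨
    (p + r) * c₂ + c₃            ≡⟨ cong (λ m → m * c₂ + c₃) (m+[n∸m]≡n p≤k) ⟩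
    k * c₂ + c₃                  ≤⟨ kc₂≤bound ⟩
    familyBound n k              ∎
    where
    open ≤-Reasoning
    r = k ∸ p
    kc₃≤k²c₃ : ∀ j → j * c₃ ≤ j * (j * c₃)
    kc₃≤k²c₃ zero    = z≤n
    kc₃≤k²c₃ (suc j) = m≤m+n (suc j * c₃) (j * (suc j * c₃))
    rc₃≤c₂ : r * c₃ ≤ c₂
    rc₃≤c₂ = ≤-trans (*-monoˡ-≤ c₃ (m∸n≤m k p)) (≤-trans (kc₃≤k²c₃ k) k²c₃≤c₂)

-- Here c₂ = 1 and c₃ = 0, so the bound is 3, the number of edges of a triangle, and `core-2` is an
-- equality. The 8 is 2k³ - 2k² - 2k + 4 at k = 2.
large-ground-2 : ∀ e → LargeGround (8 + e) 2
large-ground-2 e = record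
  { triples = z≤n
  ; core-2  = ≤-refl
  ; core-1  = s≤s (s≤s z≤n)
  ; colours = λ s s≤ → *-cancelˡ-< 2 _ _ (begin-strict
      2 * (s * 3)                ≡⟨ regroup s ⟩
      6 * s                      ≤⟨ *-monoʳ-≤ 6 (+-cancelʳ-≤ 8 s (9 + 2 * e) (≤-trans s≤ (≤-reflexive (shift e)))) ⟩
      6 * (9 + 2 * e)            <⟨ ≤-from-+ (1 + 3 * e + e * e) (identity e) ⟩
      (8 + e) * (7 + e)          ≡⟨ cong ((8 + e) *_) C-1 ⟨
      (8 + e) * ((7 + e) C 1)    ≡⟨ C-absorption (7 + e) 1 ⟨
      2 * ((8 + e) C 2)          ∎)
  }
  where
  open ≤-Reasoning
  C-1 : (7 + e) C 1 ≡ 7 + e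
  C-1 = trans (sym (*-identityˡ _)) (trans (C-absorption (6 + e) 0) (*-identityʳ _))
  regroup : ∀ s → 2 * (s * 3) ≡ 6 * s
  regroup = solve-∀
  shift : ∀ e → 2 * (8 + e) + 1 ≡ 9 + 2 * e + 8
  shift = solve-∀
  identity : ∀ e → suc (6 * (9 + 2 * e)) + (1 + 3 * e + e * e) ≡ (8 + e) * (7 + e)
  identity = solve-∀

large-ground-3+ : ∀ q e n → n ≡ 34 + 40 * q + 16 * (q * q) + 2 * (q * (q * q)) + e →
                  LargeGround n (3 + q)
large-ground-3+ q e (suc (suc (suc m₁))) n≡ = record
  { triples = 2k²c₃≤c₂
  ; core-2  = ≤-trans 2≤k-bound (m≤m+n _ 1)
  ; core-1  = begin
      2 * (c₂ + k * (k * c₃))       ≡⟨ *-distribˡ-+ 2 c₂ (k * (k * c₃)) ⟩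
      2 * c₂ + 2 * (k * (k * c₃))   ≤⟨ +-monoʳ-≤ (2 * c₂) 2k²c₃≤c₂ ⟩
      2 * c₂ + c₂                   ≤⟨ ≤-from-+ (q * c₂) (regroup q c₂) ⟩
      k * c₂                        ≤⟨ ≤-trans (m≤m+n _ c₃) (m≤m+n _ 1) ⟩
      familyBound n k               ∎
  ; colours = too-few-colours
  }
  where
  open LargeK q e m₁ (suc-injective (suc-injective (suc-injective n≡)))
  open ≤-Reasoning
  regroup : ∀ q c → 2 * c + c + q * c ≡ (3 + q) * c
  regroup = solve-∀

large-ground : ∀ n k → 2 ≤ k → 2 * k ^ 3 + 4 ≤ n + 2 * k ^ 2 + 2 * k → LargeGround n k
large-ground n 2 2≤k hyp =
  subst (λ n → LargeGround n 2) (m+[n∸m]≡n 8≤n) (large-ground-2 (n ∸ 8))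
  where
  8≤n : 8 ≤ n
  8≤n = +-cancelʳ-≤ 12 8 n (≤-trans hyp (≤-reflexive (+-assoc n 8 4)))
large-ground n (suc (suc (suc q))) 2≤k hyp =
  large-ground-3+ q (n ∸ n₀) n (sym (m+[n∸m]≡n n₀≤n))
  where
  n₀ = 34 + 40 * q + 16 * (q * q) + 2 * (q * (q * q))
  k = 3 + q
  identity : ∀ q → let k = 3 + q in
    34 + 40 * q + 16 * (q * q) + 2 * (q * (q * q)) + (2 * (k * (k * 1)) + 2 * k) ≡
    2 * (k * (k * (k * 1))) + 4
  identity = solve-∀
  n₀≤n : n₀ ≤ n
  n₀≤n = +-cancelʳ-≤ (2 * k ^ 2 + 2 * k) n₀ n (≤-trans (≤-reflexive (identity q))
           (≤-trans hyp (≤-reflexive (+-assoc n (2 * k ^ 2) (2 * k)))))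
large-ground n 1 (s≤s ()) hyp

-- Colourings from above: adding an element, starting at n = 2k.

far-apart : ∀ {t i a b} → a ≤ t → b ≡ t + 2 → (a ≡ i ⊎ a ≡ suc i) → (b ≡ i ⊎ b ≡ suc i) → Absurd
far-apart {t} {i} a≤t refl a∈ b∈ = 1+n≰n (begin
  suc (suc t)  ≡⟨ +-comm 2 t ⟩
  t + 2        ≤⟨ upper b∈ ⟩
  suc i        ≤⟨ s≤s (lower a∈) ⟩
  suc t        ∎)
  where
  open ≤-Reasoning
  upper : ∀ {b} → b ≡ i ⊎ b ≡ suc i → b ≤ suc i
  upper (inj₁ refl) = n≤1+n i
  upper (inj₂ refl) = ≤-refl
  lower : _ ≡ i ⊎ _ ≡ suc i → i ≤ t
  lower (inj₁ refl) = a≤t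
  lower (inj₂ refl) = ≤-trans (n≤1+n i) a≤t

extend-coloring : ∀ {n k t} → StarFreeColoring (KG n k) t → StarFreeColoring (KG (suc n) k) (t + 2)
extend-coloring {n} {k} {t} (c , (proper , starfree) , range) = c′ , (proper′ , starfree′) , range′
  where
  G = KG (suc n) k
  c′ : V G → ℕ
  c′ (true ∷ S , e)  = t + 2
  c′ (false ∷ S , e) = c (S , e)
  c≤t : ∀ v → c v ≤ t
  c≤t v = proj₂ (range v)
  c≢t+2 : ∀ v → c v ≢ t + 2
  c≢t+2 v eq = <⇒≱ (m<m+n t (s≤s z≤n)) (subst (_≤ t) eq (c≤t v))
  proper′ : Proper G c′
  proper′ (true ∷ S , _)  (true ∷ T , _)   adj eq = adj (zero , here)
  proper′ (true ∷ S , _)  (false ∷ T , e)  adj eq = c≢t+2 (T , e) (sym eq)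
  proper′ (false ∷ S , d) (true ∷ T , _)   adj eq = c≢t+2 (S , d) eq
  proper′ (false ∷ S , d) (false ∷ T , e)  adj eq = proper (S , d) (T , e) (drop-∷-Empty adj) eq
  starfree′ : ∀ u v w → u ≢ v → v ≢ w → u ≢ w → Adj G u v → Adj G v w →
              ¬ TwoConsecutive (c′ u) (c′ v) (c′ w)
  starfree′ (true ∷ S , _)  (true ∷ T , _)  _               _ _ _ adj _ _ = adj (zero , here)
  starfree′ _               (true ∷ T , _)  (true ∷ U , _)  _ _ _ _ adj _ = adj (zero , here)
  starfree′ (false ∷ S , d) (true ∷ T , _)  (false ∷ U , _) _ _ _ _ _ (_ , u , v , _) =
    far-apart (c≤t (S , d)) refl u v
  starfree′ (true ∷ S , _)  (false ∷ T , e) _               _ _ _ _ _ (_ , u , v , _) =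
    far-apart (c≤t (T , e)) refl v u
  starfree′ (false ∷ S , _) (false ∷ T , e) (true ∷ U , _)  _ _ _ _ _ (_ , _ , v , w) =
    far-apart (c≤t (T , e)) refl v w
  starfree′ (false ∷ S , d) (false ∷ T , e) (false ∷ U , f) u≢v v≢w u≢w adj adj′ =
    starfree (S , d) (T , e) (U , f) (distinct u≢v) (distinct v≢w) (distinct u≢w)
      (drop-∷-Empty adj) (drop-∷-Empty adj′)
    where
    distinct : ∀ {u v : Vertex n k} → without-zero u ≢ without-zero v → u ≢ v
    distinct ne refl = ne refl
  range′ : ∀ v → 1 ≤ c′ v × c′ v ≤ t + 2
  range′ (true ∷ S , _)  = m≤n⇒m≤o+n t (s≤s z≤n) , ≤-refl
  range′ (false ∷ S , e) = proj₁ (range (S , e)) , ≤-trans (c≤t (S , e)) (m≤m+n t 2)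

disjoint-∁ : ∀ {k} (u v : Vertex (2 * k) k) → Adj (KG (2 * k) k) u v → proj₁ u ≡ ∁ (proj₁ v)
disjoint-∁ {k} (S , d) (T , e) adj = ⊆-antisym S⊆∁T ∁T⊆S
  where
  S⊆∁T : S ⊆ ∁ T
  S⊆∁T x∈S = x∉p⇒x∈∁p λ x∈T → adj (_ , x∈p∩q⁺ (x∈S , x∈T))
  ∣∁T∣≡∣S∣ : ∣ ∁ T ∣ ≡ ∣ S ∣
  ∣∁T∣≡∣S∣ = begin
    ∣ ∁ T ∣          ≡⟨ ∣∁p∣≡n∸∣p∣ T ⟩
    2 * k ∸ ∣ T ∣    ≡⟨ cong (2 * k ∸_) e ⟩
    2 * k ∸ k        ≡⟨ m+n∸m≡n k (k + 0) ⟩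
    k + 0            ≡⟨ +-identityʳ k ⟩
    k                ≡⟨ d ⟨
    ∣ S ∣            ∎
    where open ≡-Reasoning
  ∁T⊆S : ∁ T ⊆ S
  ∁T⊆S {x} x∈∁T = decidable-stable (x ∈? S) λ x∉S →
    <⇒≢ (p⊂q⇒∣p∣<∣q∣ (S⊆∁T , x , x∈∁T , x∉S)) (sym ∣∁T∣≡∣S∣)

-- KG(2k,k) is a perfect matching of complementary sets: it has no path on three vertices, and just
-- one set of each pair contains the first element.
matching-coloring : ∀ k → 1 ≤ k → StarFreeColoring (KG (2 * k) k) 2
matching-coloring (suc k) _ = c , (proper , starfree) , range
  where
  G = KG (2 * suc k) (suc k)
  c : V G → ℕ
  c (true ∷ S , _)  = 1
  c (false ∷ S , _) = 2
  proper : Proper G c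
  proper u@(true ∷ S , _)  v@(true ∷ T , _)  adj _ = contradiction (disjoint-∁ u v adj) λ ()
  proper u@(false ∷ S , _) v@(false ∷ T , _) adj _ = contradiction (disjoint-∁ u v adj) λ ()
  starfree : ∀ u v w → u ≢ v → v ≢ w → u ≢ w → Adj G u v → Adj G v w → ¬ TwoConsecutive (c u) (c v) (c w)
  starfree u v w _ _ u≢w adj adj′ _ = u≢w (vertex-≡ (trans (disjoint-∁ u v adj)
    (sym (disjoint-∁ w v (λ (x , x∈) → adj′ (x , subst (x ∈_) (∩-comm (proj₁ w) (proj₁ v)) x∈))))))
  range : ∀ v → 1 ≤ c v × c v ≤ 2
  range (true ∷ S , _)  = s≤s z≤n , s≤s z≤n
  range (false ∷ S , _) = s≤s z≤n , ≤-refl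

-- Two colours for the matching and two more for each further element.
coloring : ∀ k → 1 ≤ k → ∀ e → StarFreeColoring (KG (e + 2 * k) k) (2 + 2 * e)
coloring k 1≤k zero    = matching-coloring k 1≤k
coloring k 1≤k (suc e) = subst (StarFreeColoring (KG (suc e + 2 * k) k)) (identity e)
  (extend-coloring (coloring k 1≤k e))
  where
  identity : ∀ e → 2 + 2 * e + 2 ≡ 2 + 2 * suc e
  identity = solve-∀

-- Deleting an element and closing the gap in the colours.

∣insertAt∣ : ∀ {n} (S : Subset n) x → ∣ insertAt S x false ∣ ≡ ∣ S ∣
∣insertAt∣ S           zero    = refl
∣insertAt∣ (true ∷ S)  (suc x) = cong suc (∣insertAt∣ S x)
∣insertAt∣ (false ∷ S) (suc x) = ∣insertAt∣ S x

insertAt-∩ : ∀ {n} (S T : Subset n) x →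
  insertAt S x false ∩ insertAt T x false ≡ insertAt (S ∩ T) x false
insertAt-∩ S       T       zero    = refl
insertAt-∩ (s ∷ S) (t ∷ T) (suc x) = cong (_ ∷_) (insertAt-∩ S T x)

insertAt-Empty : ∀ {n} (S : Subset n) x → Empty S → Empty (insertAt S x false)
insertAt-Empty S       zero    S-empty (suc y , there y∈) = S-empty (y , y∈)
insertAt-Empty (s ∷ S) (suc x) S-empty (zero , here)      = S-empty (zero , here)
insertAt-Empty (s ∷ S) (suc x) S-empty (suc y , there y∈) =
  insertAt-Empty S x (drop-∷-Empty S-empty) (y , y∈)

module _ {n k : ℕ} (x : Fin (suc n)) where

  insert : Vertex n k → Vertex (suc n) k
  insert (S , e) = insertAt S x false , trans (∣insertAt∣ S x) e

  insert-avoids : ∀ v → x ∉ proj₁ (insert v)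
  insert-avoids (S , e) x∈ with trans (sym (insertAt-lookup S x false)) ([]=⇒lookup x∈)
  ... | ()

  insert-injective : ∀ {u v} → insert u ≡ insert v → u ≡ v
  insert-injective {S , _} {T , _} eq = vertex-≡ (begin
    S                                     ≡⟨ removeAt-insertAt S x false ⟨
    removeAt (insertAt S x false) x       ≡⟨ cong (λ u → removeAt (proj₁ u) x) eq ⟩
    removeAt (insertAt T x false) x       ≡⟨ removeAt-insertAt T x false ⟩
    T                                     ∎)
    where open ≡-Reasoning

  insert-adj : ∀ u v → Adj (KG n k) u v → Adj (KG (suc n) k) (insert u) (insert v)
  insert-adj (S , _) (T , _) adj =
    subst Empty (sym (insertAt-∩ S T x)) (insertAt-Empty (S ∩ T) x adj)

Away : ℕ → ℕ → Set
Away j m = 2 + m ≤ j ⊎ 2 + j ≤ m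

away : ∀ {j m} → m ≢ j → suc m ≢ j → m ≢ suc j → Away j m
away {j} {m} m≢j m+1≢j m≢j+1 with m <? j
... | yes m<j = inj₁ (≤∧≢⇒< m<j m+1≢j)
... | no m≮j  = inj₂ (≤∧≢⇒< (≤∧≢⇒< (≮⇒≥ m≮j) (m≢j ∘ sym)) (m≢j+1 ∘ sym))

-- Three values j - 1, j, j + 1 are free, but the upper side moves down by two only. The lower side
-- then ends at j - 2 and the upper one begins at j, so j - 1 still separates them and no new
-- consecutive pair arises.
collapse : ℕ → ℕ → ℕ
collapse j m with m <? j
... | yes _ = m
... | no _  = m ∸ 2

collapse-low : ∀ {j m} → 2 + m ≤ j → collapse j m ≡ m
collapse-low {j} {m} low with m <? j
... | yes _   = refl
... | no m≮j  = contradiction (≤-trans (n≤1+n _) low) m≮j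

collapse-high : ∀ {j m} → 2 + j ≤ m → 2 + collapse j m ≡ m
collapse-high {j} {m} high with m <? j
... | yes m<j = contradiction (≤-trans (m≤n+m j 2) high) (<⇒≱ m<j)
... | no _    = m+[n∸m]≡n (≤-trans (m≤m+n 2 j) high)

collapse-injective : ∀ {j a b} → Away j a → Away j b → collapse j a ≡ collapse j b → a ≡ b
collapse-injective {j} {a} {b} (inj₁ la) (inj₁ lb) eq =
  trans (sym (collapse-low la)) (trans eq (collapse-low lb))
collapse-injective {j} {a} {b} (inj₂ ha) (inj₂ hb) eq =
  trans (sym (collapse-high ha)) (trans (cong (2 +_) eq) (collapse-high hb))
collapse-injective {j} {a} {b} (inj₁ la) (inj₂ hb) eq =
  contradiction (subst (2 + j ≤_) (sym 2+a≡b) hb) (<⇒≱ (s≤s (m≤n⇒m≤1+n la)))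
  where
  2+a≡b : 2 + a ≡ b
  2+a≡b = trans (cong (2 +_) (trans (sym (collapse-low la)) eq)) (collapse-high hb)
collapse-injective {j} {a} {b} (inj₂ ha) (inj₁ lb) eq =
  sym (collapse-injective (inj₁ lb) (inj₂ ha) (sym eq))

-- Two consecutive values of collapse j come from colours on the same side of j.
collapse-consecutive : ∀ {j a b c} → Away j a → Away j b → Away j c →
  TwoConsecutive (collapse j a) (collapse j b) (collapse j c) → TwoConsecutive a b c
collapse-consecutive {j} {a} {b} {c} aw bw cw (i , a∈ , b∈ , c∈) with 2 + i ≤? j
... | yes low  = i , below aw a∈ , below bw b∈ , below cw c∈
  where
  below : ∀ {m} → Away j m → collapse j m ≡ i ⊎ collapse j m ≡ suc i → m ≡ i ⊎ m ≡ suc i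
  below (inj₁ lm) m∈ = subst (λ z → z ≡ i ⊎ z ≡ suc i) (collapse-low lm) m∈
  below {m} (inj₂ hm) m∈ = contradiction (begin
    j              ≤⟨ ≤-pred (≤-pred (subst (2 + j ≤_) (sym (collapse-high hm)) hm)) ⟩
    collapse j m   ≤⟨ upper m∈ ⟩
    suc i          ∎) (<⇒≱ low)
    where
    open ≤-Reasoning
    upper : collapse j m ≡ i ⊎ collapse j m ≡ suc i → collapse j m ≤ suc i
    upper (inj₁ eq) = ≤-trans (≤-reflexive eq) (n≤1+n i)
    upper (inj₂ eq) = ≤-reflexive eq
... | no ¬low  = 2 + i , above aw a∈ , above bw b∈ , above cw c∈
  where
  above : ∀ {m} → Away j m → collapse j m ≡ i ⊎ collapse j m ≡ suc i → m ≡ 2 + i ⊎ m ≡ 3 + i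
  above (inj₂ hm) (inj₁ eq) = inj₁ (trans (sym (collapse-high hm)) (cong (2 +_) eq))
  above (inj₂ hm) (inj₂ eq) = inj₂ (trans (sym (collapse-high hm)) (cong (2 +_) eq))
  above {m} (inj₁ lm) m∈ = contradiction (≤-trans (s≤s (s≤s (lower m∈))) lm) ¬low
    where
    lower : collapse j m ≡ i ⊎ collapse j m ≡ suc i → i ≤ m
    lower (inj₁ eq) = ≤-reflexive (trans (sym eq) (collapse-low lm))
    lower (inj₂ eq) = ≤-trans (n≤1+n i) (≤-reflexive (trans (sym eq) (collapse-low lm)))

-- Two colours are saved even for `j` at an end of the range: the lower side stays within j - 2 ≤ s
-- - 2, and the upper side comes down to at least j ≥ 1.
collapse-range : ∀ {j m s} → 1 ≤ j → j ≤ s → 1 ≤ m → m ≤ s → Away j m →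
  1 ≤ collapse j m × collapse j m ≤ s ∸ 2
collapse-range {j} {m} {s} 1≤j j≤s 1≤m m≤s (inj₁ lm) rewrite collapse-low lm =
  1≤m , ∸-monoˡ-≤ 2 (≤-trans lm j≤s)
collapse-range {j} {m} {s} 1≤j j≤s 1≤m m≤s (inj₂ hm) =
  ≤-trans 1≤j (≤-pred (≤-pred (subst (2 + j ≤_) (sym (collapse-high hm)) hm))) ,
  ∸-monoˡ-≤ 2 (≤-trans (≤-reflexive (collapse-high hm)) m≤s)

delete-element : ∀ {n k s} (x : Fin (suc n)) j → 1 ≤ j → j ≤ s →
  ((c , _) : StarFreeColoring (KG (suc n) k) s) →
  (∀ v → x ∉ proj₁ v → Away j (c v)) →
  StarFreeColoring (KG n k) (s ∸ 2)
delete-element {n} {k} {s} x j 1≤j j≤s (c , (proper , starfree) , range) aw =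
  c′ , (proper′ , starfree′) , range′
  where
  G = KG n k
  c′ : V G → ℕ
  c′ v = collapse j (c (insert x v))
  aw′ : ∀ v → Away j (c (insert x v))
  aw′ v = aw (insert x v) (insert-avoids x v)
  proper′ : Proper G c′
  proper′ u v adj eq = proper (insert x u) (insert x v) (insert-adj x u v adj)
    (collapse-injective (aw′ u) (aw′ v) eq)
  starfree′ : ∀ u v w → u ≢ v → v ≢ w → u ≢ w → Adj G u v → Adj G v w →
              ¬ TwoConsecutive (c′ u) (c′ v) (c′ w)
  starfree′ u v w u≢v v≢w u≢w adj adj′ tc =
    starfree (insert x u) (insert x v) (insert x w)
      (u≢v ∘ insert-injective x) (v≢w ∘ insert-injective x) (u≢w ∘ insert-injective x)
      (insert-adj x u v adj) (insert-adj x v w adj′)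
      (collapse-consecutive (aw′ u) (aw′ v) (aw′ w) tc)
  range′ : ∀ v → 1 ≤ c′ v × c′ v ≤ s ∸ 2
  range′ v = collapse-range 1≤j j≤s (proj₁ (range (insert x v))) (proj₂ (range (insert x v))) (aw′ v)

-- Colour classes: popular elements and the total count.

module Classes {n k s : ℕ} (χ : StarFreeColoring (KG n k) s) where

  c = proj₁ χ
  proper = proj₁ (proj₁ (proj₂ χ))
  starfree = proj₂ (proj₁ (proj₂ χ))
  range = proj₂ (proj₂ χ)

  class? : ∀ j → Decidable (λ v → c v ≡ j)
  class? j v = c v ≟ j

  class-intersecting : ∀ j u v → c u ≡ j → c v ≡ j → Nonempty (proj₁ u ∩ proj₁ v)
  class-intersecting j u v cu cv = decidable-stable (nonempty? (proj₁ u ∩ proj₁ v))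
    λ e → proper u v e (trans cu (sym cv))

  -- Two members of class j disjoint from v would form with v a path coloured by j and c v.
  popular⇒away : ∀ j x → k * supersets n k 2 + 2 ≤ Family.degree (class? j) x →
                 ∀ v → x ∉ proj₁ v → Away j (c v)
  popular⇒away j x popular v x∉v = away
    (λ cv≡j → proper u v u-disjoint (trans cu≡j (sym cv≡j)))
    (λ 1+cv≡j → path (c v , inj₂ (trans cu≡j (sym 1+cv≡j)) , inj₁ refl , inj₂ (trans cw≡j (sym 1+cv≡j))))
    (λ cv≡1+j → path (j , inj₁ cu≡j , inj₂ cv≡1+j , inj₁ cw≡j))
    where
    open Family (class? j) using (degree; through?)
    vs = vertices n k
    meeting? : Decidable (λ u → x ∈ᵥ u × Nonempty (proj₁ v ∩ proj₁ u))
    meeting? u = x ∈ᵥ? u ×-dec nonempty? (proj₁ v ∩ proj₁ u)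
    disjoint? : Decidable (λ u → c u ≡ j × Empty (proj₁ u ∩ proj₁ v))
    disjoint? u = class? j u ×-dec ¬? (nonempty? (proj₁ u ∩ proj₁ v))
    meeting-bound : count meeting? vs ≤ k * supersets n k 2
    meeting-bound = subst (λ m → count meeting? vs ≤ m * supersets n k 2) (proj₂ v)
      (count-cover (proj₁ v) meeting? (contains-pair? k x) _ vs
        (λ u (x∈u , b , b∈) → let (b∈v , b∈u) = x∈p∩q⁻ (proj₁ v) (proj₁ u) b∈ in b , b∈v , x∈u , b∈u)
        (λ b b∈v → count-pair {n} k λ { refl → x∉v b∈v }))
    split : ∀ u → c u ≡ j × x ∈ᵥ u →
      (x ∈ᵥ u × Nonempty (proj₁ v ∩ proj₁ u)) ⊎ (c u ≡ j × Empty (proj₁ u ∩ proj₁ v))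
    split u (cu , x∈u) with nonempty? (proj₁ v ∩ proj₁ u)
    ... | yes ne = inj₁ (x∈u , ne)
    ... | no e   = inj₂ (cu , subst Empty (∩-comm (proj₁ v) (proj₁ u)) e)
    -- The sets through `x` that meet `v` use up the first summand of the threshold; its 2 remains.
    two-disjoint : 2 ≤ count disjoint? vs
    two-disjoint = +-cancelˡ-≤ (k * supersets n k 2) 2 _ (≤-trans popular
      (≤-trans (count-split (through? x) meeting? disjoint? split vs)
        (+-monoˡ-≤ (count disjoint? vs) meeting-bound)))
    first : ∃ λ u → c u ≡ j × Empty (proj₁ u ∩ proj₁ v)
    first = count-witness disjoint? vs (≤-trans (s≤s z≤n) two-disjoint)
    u = proj₁ first
    cu≡j = proj₁ (proj₂ first)
    u-disjoint = proj₂ (proj₂ first)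
    -- Being different from `u` is put as non-inclusion, because `count-self` bounds the vertices
    -- that contain `u`.
    other? : Decidable (λ w → (c w ≡ j × Empty (proj₁ w ∩ proj₁ v)) × ¬ (proj₁ u ⊆ proj₁ w))
    other? w = disjoint? w ×-dec ¬? (⊆ᵥ? (proj₁ u) w)
    split-off : ∀ w → c w ≡ j × Empty (proj₁ w ∩ proj₁ v) → proj₁ u ⊆ proj₁ w ⊎
      ((c w ≡ j × Empty (proj₁ w ∩ proj₁ v)) × ¬ (proj₁ u ⊆ proj₁ w))
    split-off w d with ⊆ᵥ? (proj₁ u) w
    ... | yes u⊆w = inj₁ u⊆w
    ... | no u⊈w  = inj₂ (d , u⊈w)
    second : ∃ λ w → (c w ≡ j × Empty (proj₁ w ∩ proj₁ v)) × ¬ (proj₁ u ⊆ proj₁ w)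
    second = count-witness other? vs (+-cancelˡ-≤ 1 1 _ (≤-trans two-disjoint
      (≤-trans (count-split disjoint? (⊆ᵥ? (proj₁ u)) other? split-off vs)
        (+-monoˡ-≤ (count other? vs) (count-self k u)))))
    w = proj₁ second
    cw≡j = proj₁ (proj₁ (proj₂ second))
    w-disjoint = proj₂ (proj₁ (proj₂ second))
    u≢w : u ≢ w
    u≢w u≡w = proj₂ (proj₂ second) (⊆-reflexive (cong proj₁ u≡w))
    path : ¬ TwoConsecutive (c u) (c v) (c w)
    path tc@(i , u∈ , v∈ , w∈) = starfree u v w
      (λ u≡v → v-is-not cu≡j (sym (cong c u≡v))) (λ v≡w → v-is-not cw≡j (cong c v≡w)) u≢w
      u-disjoint (subst Empty (∩-comm (proj₁ w) (proj₁ v)) w-disjoint) tc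
      where
      v-is-not : ∀ {z} → z ≡ j → c v ≡ z → Absurd
      v-is-not z≡j cv≡z = proper u v u-disjoint (trans cu≡j (sym (trans cv≡z z≡j)))

  class-≤ : LargeGround n k → Fin n →
    (∀ j x → 1 ≤ j → j ≤ s → Family.degree (class? j) x < k * supersets n k 2 + 2) →
    ∀ j → 1 ≤ j → j ≤ s → count (class? j) (vertices n k) ≤ familyBound n k
  class-≤ large x₀ unpopular j 1≤j j≤s =
    Family.size-≤ (class? j) (class-intersecting j) x₀ star≤ core-≤k core-2 core-1 core-0
    where
    open LargeGround large
    star≤ : ∀ x → Family.degree (class? j) x ≤ familyBound n k
    star≤ x = ≤-pred (begin
      suc (Family.degree (class? j) x)  ≤⟨ unpopular j x 1≤j j≤s ⟩
      k * c₂ + 2                        ≡⟨ +-suc (k * c₂) 1 ⟩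
      suc (k * c₂ + 1)                  ≤⟨ s≤s (+-monoˡ-≤ 1 (m≤m+n (k * c₂) c₃)) ⟩
      suc (familyBound n k)             ∎)
      where open ≤-Reasoning

  vertices-≤ : ∀ m → (∀ j → 1 ≤ j → j ≤ s → count (class? j) (vertices n k) ≤ m) → n C k ≤ s * m
  vertices-≤ m bound = begin
    n C k
      ≡⟨ length-vertices n k ⟨
    length (vertices n k)
      ≡⟨ cong length (filter-all every? (All.universal (λ _ → tt) (vertices n k))) ⟨
    count every? (vertices n k)
      ≤⟨ count-cover full every? (λ j → class? (suc (toℕ j))) m (vertices n k)
           cover (λ j _ → bound (suc (toℕ j)) (s≤s z≤n) (toℕ<n j)) ⟩
    ∣ full {s} ∣ * m
      ≡⟨ cong (_* m) (∣⊤∣≡n s) ⟩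
    s * m ∎
    where
    open ≤-Reasoning
    every? : Decidable (λ (_ : Vertex n k) → ⊤)
    every? _ = yes tt
    cover : ∀ v → ⊤ → ∃ λ (j : Fin s) → j ∈ full × c v ≡ suc (toℕ j)
    cover v _ with c v | range v
    ... | suc m | _ , m<s = fromℕ< m<s , ∈⊤ , cong suc (sym (toℕ-fromℕ< m<s))

  not-all-unpopular : LargeGround n k → Fin n → s + 4 * k ≤ 2 * n + 1 →
    ¬ (∀ j x → 1 ≤ j → j ≤ s → Family.degree (class? j) x < k * supersets n k 2 + 2)
  not-all-unpopular large x₀ s≤ unpopular =
    <⇒≱ (LargeGround.colours large s s≤) (vertices-≤ (familyBound n k) (class-≤ large x₀ unpopular))

-- The recursion for the chromatic number.

first-vertex : ∀ {n k} → k ≤ n → Vertex n k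
first-vertex {n} {k} k≤n with vertices n k | length-vertices n k
... | v ∷ _ | _  = v
... | []    | eq = contradiction (subst (1 ≤_) (sym eq) (C-positive k≤n)) λ ()

-- Excludes n = 2k, so that n - 1 ≥ 2k and the colouring built up from the matching exists for
-- KG(n-1,k).
cubic-bound : ∀ k → 2 ≤ k → ¬ (2 * k ^ 3 + 4 ≤ 2 * k + 2 * k ^ 2 + 2 * k)
cubic-bound 1             (s≤s ())
cubic-bound (suc (suc r)) _ = <⇒≱ (≤-from-+ (3 + 12 * r + 10 * (r * r) + 2 * (r * (r * r))) (identity r))
  where
  identity : ∀ r → let k = 2 + r in
    suc (2 * k + 2 * (k * (k * 1)) + 2 * k) + (3 + 12 * r + 10 * (r * r) + 2 * (r * (r * r))) ≡
    2 * (k * (k * (k * 1))) + 4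
  identity = solve-∀

theorem1 : ∀ (n k t : ℕ) → 1 ≤ k → 4 ≤ 2 * k → 2 * k ≤ n →
    2 * k ^ 3 + 4 ≤ n + 2 * k ^ 2 + 2 * k →
    IsStarFreeChromaticNumber (KG (n ∸ 1) k) t →
    IsStarFreeChromaticNumber (KG n k) (t + 2)
theorem1 zero    k t 1≤k 4≤2k 2k≤n hyp _ = contradiction (≤-trans 4≤2k 2k≤n) λ ()
theorem1 (suc n) k t 1≤k 4≤2k 2k≤1+n hyp (1≤t , χ , minimal) =
  m≤n⇒m≤n+o 2 1≤t , extend-coloring χ , lower
  where
  large : LargeGround (suc n) k
  large = large-ground (suc n) k (*-cancelˡ-≤ 2 4≤2k) hyp
  2k≢1+n : 2 * k ≢ suc n
  2k≢1+n 2k≡1+n = cubic-bound k (*-cancelˡ-≤ 2 4≤2k)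
    (subst (λ n → 2 * k ^ 3 + 4 ≤ n + 2 * k ^ 2 + 2 * k) (sym 2k≡1+n) hyp)
  2k≤n : 2 * k ≤ n
  2k≤n = ≤-pred (≤∧≢⇒< 2k≤1+n 2k≢1+n)
  e = n ∸ 2 * k
  n≡ : e + 2 * k ≡ n
  n≡ = m∸n+n≡m 2k≤n
  t≤ : t ≤ 2 + 2 * e
  t≤ = minimal (2 + 2 * e) (s≤s z≤n)
    (subst (λ n → StarFreeColoring (KG n k) (2 + 2 * e)) n≡ (coloring k 1≤k e))
  few : ∀ {s} → s < t + 2 → s + 4 * k ≤ 2 * suc n + 1
  few {s} s<t+2 = begin
    s + 4 * k                  ≤⟨ +-monoˡ-≤ (4 * k) (≤-pred (≤-trans s<t+2 (+-monoˡ-≤ 2 t≤))) ⟩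
    1 + (2 * e + 2) + 4 * k    ≡⟨ identity e k ⟩
    2 * suc (e + 2 * k) + 1    ≡⟨ cong (λ n → 2 * suc n + 1) n≡ ⟩
    2 * suc n + 1              ∎
    where
    open ≤-Reasoning
    identity : ∀ e k → 1 + (2 * e + 2) + 4 * k ≡ 2 * suc (e + 2 * k) + 1
    identity = solve-∀
  smaller : ∀ {s} → StarFreeColoring (KG n k) (s ∸ 2) → t + 2 ≤ s
  smaller {s} ψ@(_ , _ , range) = begin
    t + 2      ≤⟨ +-monoˡ-≤ 2 (minimal (s ∸ 2) 1≤s∸2 ψ) ⟩
    s ∸ 2 + 2  ≡⟨ m∸n+n≡m (<⇒≤ (m∸n≢0⇒n<m {s} {2} (>⇒≢ 1≤s∸2))) ⟩
    s          ∎
    where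
    open ≤-Reasoning
    v : Vertex n k
    v = first-vertex (≤-trans (m≤m+n k (k + 0)) 2k≤n)
    -- The colour of an actual vertex lies between 1 and `s ∸ 2`, so the subtraction is not
    -- truncated.
    1≤s∸2 : 1 ≤ s ∸ 2
    1≤s∸2 = ≤-trans (proj₁ (range v)) (proj₂ (range v))
  lower : ∀ s → 1 ≤ s → StarFreeColoring (KG (suc n) k) s → t + 2 ≤ s
  -- No popular pair has to be searched for: if `s` is below `t + 2`, any popular pair gives a
  -- contradiction by deletion, so every pair is unpopular, which the count forbids.
  lower s _ ψ = decidable-stable (t + 2 ≤? s) λ t+2≰s →
    Classes.not-all-unpopular ψ large zero (few (≰⇒> t+2≰s)) λ j x 1≤j j≤s → ≰⇒> λ popular →
      t+2≰s (smaller (delete-element x j 1≤j j≤s ψ (Classes.popular⇒away ψ j x popular)))
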